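{- Let $(S,\mathrm{dist})$ be a finite metric space with $n=|S|\ge 2$ points in which every nonzero distance equals $1$ or $2$. Then either $S$ has at least $n$ distinct lines, or some line of $S$ equals $S$ (i.e., consists of all $n$ points).
   Context: For distinct points $u,v$ of a metric space $(S,\mathrm{dist})$, the line $\overline{uv}$ is defined as the set of all points $p\in S$ such that $\mathrm{dist}(p,u)+\mathrm{dist}(u,v)=\mathrm{dist}(p,v)$, or $\mathrm{dist}(u,p)+\mathrm{dist}(p,v)=\mathrm{dist}(u,v)$, or $\mathrm{dist}(u,v)+\mathrm{dist}(v,p)=\mathrm{dist}(u,p)$. Lines are regarded as sets of points, so two lines $\overline{uv}$ and $\overline{xy}$ are the same line when they are equal as subsets of $S$; "the number of distinct lines" counts distinct such subsets. -}

module Defs where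

open import Data.Nat using (ℕ; _+_; _≤_)
open import Data.Fin using (Fin)
open import Data.Sum using (_⊎_)
open import Data.Product using (_×_; Σ; Σ-syntax)
open import Relation.Binary.PropositionalEquality using (_≡_; _≢_)
open import Relation.Nullary using (¬_)
open import Function.Bundles using (_⇔_)

record IsMetric {n : ℕ} (dist : Fin n → Fin n → ℕ) : Set where
  field
    zero-iff : ∀ x y → (dist x y ≡ 0 → x ≡ y) × (x ≡ y → dist x y ≡ 0)
    symmetric : ∀ x y → dist x y ≡ dist y x
    triangle : ∀ x y z → dist x z ≤ dist x y + dist y z

OneTwo : {n : ℕ} → (Fin n → Fin n → ℕ) → Set
OneTwo {n} dist = ∀ x y → dist x y ≢ 0 → (dist x y ≡ 1) ⊎ (dist x y ≡ 2)

OnLine : {n : ℕ} → (Fin n → Fin n → ℕ) → Fin n → Fin n → Fin n → Set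
OnLine dist u v p =
  (dist p u + dist u v ≡ dist p v)
  ⊎ ((dist u p + dist p v ≡ dist u v)
  ⊎ (dist u v + dist v p ≡ dist u p))

SameLine : {n : ℕ} → (Fin n → Fin n → ℕ) → Fin n → Fin n → Fin n → Fin n → Set
SameLine dist u v x y = ∀ p → OnLine dist u v p ⇔ OnLine dist x y p

AtLeastNLines : {n : ℕ} → (Fin n → Fin n → ℕ) → Set
AtLeastNLines {n} dist =
  Σ[ u ∈ (Fin n → Fin n) ] Σ[ v ∈ (Fin n → Fin n) ]
    ((∀ i → u i ≢ v i)
    × (∀ i j → i ≢ j → ¬ SameLine dist (u i) (v i) (u j) (v j)))

UniversalLine : {n : ℕ} → (Fin n → Fin n → ℕ) → Set
UniversalLine {n} dist =
  Σ[ u ∈ Fin n ] Σ[ v ∈ Fin n ] (u ≢ v × (∀ p → OnLine dist u v p))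

{-# OPTIONS --safe #-}

-- Call points at distance 1 adjacent, and call two points twins when they are
-- at distance 2 and have the same distance to every other point.
--
-- Suppose that there are no twins and fix a point u.  Two lines uv and uw with
-- v ≠ w can only coincide when one of v, w, say v, is adjacent to u and the
-- other is not; let V be the set of these v.  Label every p ∉ V ∪ {u} with the
-- line up.  It remains to label V ∪ {u} by distinct lines that miss u.  If V
-- is empty, any line missing u will do (if there is none, every line through u
-- is universal).  Otherwise take v ∈ V with uv = uw.  Unless vw is universal
-- it misses a point b, which is then adjacent to none of u, v, w.  Label u
-- with wb, a point p ∈ V not adjacent to b with pb, and the point p ∈ V
-- adjacent to b (there is at most one) with vp.
--
-- If u and u′ are twins, then either uu′ is universal or u has another
-- non-neighbour y; in the second case, remove u′ and use induction: the line
-- u′y is new because it contains u′ but not u.  A universal line of the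
-- smaller space stays universal unless u, u′ and a third point z are pairwise
-- twins adjacent to everything else.  In that case remove both u′ and z: every
-- line of the rest extends to one containing all or none of u, u′, z, so that
-- uu′ and uz are two new lines.

module Submission where

open import Defs
open import Data.Nat using (ℕ; zero; suc; _+_; _≤_; z≤n; s≤s)
import Data.Nat.Properties as ℕ
open import Data.Fin using (Fin; zero; suc; punchIn; punchOut)
open import Data.Fin.Properties using (_≟_; any?; all?; punchInᵢ≢i; punchIn-injective; punchIn-punchOut; ¬∀⟶∃¬)
open import Data.Sum using (_⊎_; inj₁; inj₂; [_,_]′)
open import Data.Product using (_×_; _,_; ∃; ∃₂; ∃-syntax; proj₁; proj₂)
open import Data.Empty using (⊥)
open import Function using (_∘_; Injective; _⇔_; mk⇔; Equivalence)
open import Relation.Binary.PropositionalEquality using (_≡_; _≢_; refl; sym; trans; cong; subst)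
open import Relation.Nullary using (¬_; Dec; yes; no; contradiction; ¬?; _×-dec_; _⊎-dec_; _→-dec_)
open import Relation.Nullary.Decidable using (True; False; toWitness; toWitnessFalse; map′; decidable-stable)

-- Preliminaries: removing an index, and collinearity of three distances.

punchIn-surjective : ∀ {n} {a p : Fin (suc n)} → p ≢ a → ∃[ i ] punchIn a i ≡ p
punchIn-surjective p≢a = punchOut (p≢a ∘ sym) , punchIn-punchOut (p≢a ∘ sym)

-- The arguments stand for `d u v`, `d u p`, `d v p`; the cases keep the order of `OnLine`.
Col : ℕ → ℕ → ℕ → Set
Col a b c = (b + a ≡ c) ⊎ ((b + c ≡ a) ⊎ (a + c ≡ b))

col? : ∀ a b c → Dec (Col a b c)
col? a b c = (b + a ℕ.≟ c) ⊎-dec ((b + c ℕ.≟ a) ⊎-dec (a + c ℕ.≟ b))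

col-swap : ∀ {a b c} → Col a b c → Col a c b
col-swap {a} {b} {c} (inj₁ e) = inj₂ (inj₂ (trans (ℕ.+-comm a b) e))
col-swap {a} {b} {c} (inj₂ (inj₁ e)) = inj₂ (inj₁ (trans (ℕ.+-comm c b) e))
col-swap {a} {b} {c} (inj₂ (inj₂ e)) = inj₁ (trans (ℕ.+-comm c a) e)

col-rotate : ∀ {a b c} → Col a b c → Col b c a
col-rotate {a} {b} {c} (inj₁ e) = inj₂ (inj₂ e)
col-rotate {a} {b} {c} (inj₂ (inj₁ e)) = inj₁ (trans (ℕ.+-comm c b) e)
col-rotate {a} {b} {c} (inj₂ (inj₂ e)) = inj₂ (inj₁ (trans (ℕ.+-comm c a) e))

-- Families of distinct lines.

record Lines {n : ℕ} (d : Fin n → Fin n → ℕ) (m : ℕ) (Q : Fin n → Fin n → Set) : Set where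
  constructor mkLines
  field
    left right : Fin m → Fin n
    satisfies  : ∀ i → Q (left i) (right i)
    left≢right : ∀ i → left i ≢ right i
    distinct   : ∀ i j → i ≢ j → ¬ SameLine d (left i) (right i) (left j) (right j)

Conclusion : ∀ {n} → (Fin n → Fin n → ℕ) → Set
Conclusion d = AtLeastNLines d ⊎ UniversalLine d

Theorem : ℕ → Set
Theorem n = (d : Fin n → Fin n → ℕ) → IsMetric d → OneTwo d → Conclusion d

module LineFamilies {n : ℕ} (d : Fin n → Fin n → ℕ) where

  SameLine-sym : ∀ {a b x y} → SameLine d a b x y → SameLine d x y a b
  SameLine-sym s p = mk⇔ (Equivalence.from (s p)) (Equivalence.to (s p))

  separate : ∀ {a b x y} p → OnLine d a b p → ¬ OnLine d x y p → ¬ SameLine d a b x y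
  separate p on off s = off (Equivalence.to (s p) on)

  separate′ : ∀ {a b x y} p → ¬ OnLine d a b p → OnLine d x y p → ¬ SameLine d a b x y
  separate′ p off on = separate p on off ∘ SameLine-sym

  noLines : ∀ {Q} → Lines d 0 Q
  noLines = mkLines (λ ()) (λ ()) (λ ()) (λ ()) λ ()

  -- The predicate records which pairs span the family: whether a further line is new depends on
  -- where the old ones come from.
  addLine : ∀ {m Q} x y → x ≢ y → (∀ {a b} → a ≢ b → Q a b → ¬ SameLine d a b x y) →
            Lines d m Q → Lines d (suc m) (λ a b → (a ≡ x × b ≡ y) ⊎ Q a b)
  addLine {m} {Q} x y x≢y new (mkLines a b q a≢b distinct) = mkLines a′ b′ q′ a′≢b′ distinct′
    where
    a′ b′ : Fin (suc m) → Fin n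
    a′ zero = x
    a′ (suc i) = a i
    b′ zero = y
    b′ (suc i) = b i
    q′ : ∀ i → (a′ i ≡ x × b′ i ≡ y) ⊎ Q (a′ i) (b′ i)
    q′ zero = inj₁ (refl , refl)
    q′ (suc i) = inj₂ (q i)
    a′≢b′ : ∀ i → a′ i ≢ b′ i
    a′≢b′ zero = x≢y
    a′≢b′ (suc i) = a≢b i
    distinct′ : ∀ i j → i ≢ j → ¬ SameLine d (a′ i) (b′ i) (a′ j) (b′ j)
    distinct′ zero zero i≢j = contradiction refl i≢j
    distinct′ zero (suc j) _ = new (a≢b j) (q j) ∘ SameLine-sym
    distinct′ (suc i) zero _ = new (a≢b i) (q i)
    distinct′ (suc i) (suc j) i≢j = distinct i j (i≢j ∘ cong suc)

  Lines⇒AtLeastNLines : ∀ {Q} → Lines d n Q → AtLeastNLines d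
  Lines⇒AtLeastNLines (mkLines a b _ a≢b distinct) = a , b , a≢b , distinct

  -- The induction hypothesis for the subspace of the points `f i`. Lines that differ there still
  -- differ in the whole space, but a universal line is only known to contain the image of `f`.
  restrict : ∀ {m} → Theorem m → IsMetric d → OneTwo d →
             (f : Fin m → Fin n) → Injective _≡_ _≡_ f →
             Lines d m (λ a b → (∃[ i ] f i ≡ a) × (∃[ j ] f j ≡ b))
             ⊎ (∃[ i ] ∃[ j ] (f i ≢ f j × (∀ k → OnLine d (f i) (f j) (f k))))
  restrict thm M O f inj with thm (λ i j → d (f i) (f j)) metric (λ i j → O (f i) (f j))
    where
    open IsMetric M
    metric : IsMetric (λ i j → d (f i) (f j))
    metric = record
      { zero-iff = λ i j → inj ∘ proj₁ (zero-iff (f i) (f j)) , proj₂ (zero-iff (f i) (f j)) ∘ cong f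
      ; symmetric = λ i j → symmetric (f i) (f j)
      ; triangle = λ i j k → triangle (f i) (f j) (f k)
      }
  ... | inj₁ (a , b , a≢b , distinct) =
    inj₁ (mkLines (f ∘ a) (f ∘ b) (λ i → (a i , refl) , (b i , refl)) (λ i → a≢b i ∘ inj)
           λ i j i≢j s → distinct i j i≢j (s ∘ f))
  ... | inj₂ (i , j , i≢j , all) = inj₂ (i , j , i≢j ∘ inj , all)

-- Metric spaces with distances 1 and 2.

module Space {n : ℕ} (d : Fin n → Fin n → ℕ) (M : IsMetric d) (O : OneTwo d) where
  open IsMetric M
  open LineFamilies d public

  Adj Non : Fin n → Fin n → Set
  Adj x y = d x y ≡ 1
  Non x y = d x y ≡ 2

  dxx≡0 : ∀ x → d x x ≡ 0
  dxx≡0 x = proj₂ (zero-iff x x) refl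

  d≡⇒≢ : ∀ {k x y} → d x y ≡ suc k → x ≢ y
  d≡⇒≢ {x = x} e refl with () ← trans (sym (dxx≡0 x)) e

  flip-d : ∀ {k x y} → d x y ≡ k → d y x ≡ k
  flip-d e = trans (symmetric _ _) e

  ¬Adj∧Non : ∀ {x y} → Adj x y → ¬ Non x y
  ¬Adj∧Non e f with () ← trans (sym e) f

  adj∨non : ∀ {x y} → x ≢ y → Adj x y ⊎ Non x y
  adj∨non x≢y = O _ _ (x≢y ∘ proj₁ (zero-iff _ _))

  Adj-Non-≢ : ∀ {x y z} → Adj x y → Non x z → y ≢ z
  Adj-Non-≢ e f refl = ¬Adj∧Non e f

  OnLine⇔Col : ∀ u v p → OnLine d u v p ⇔ Col (d u v) (d u p) (d v p)
  OnLine⇔Col u v p rewrite symmetric p u | symmetric p v = mk⇔ (λ c → c) (λ c → c)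

  onLine⇒col : ∀ {a b c u v p} → d u v ≡ a → d u p ≡ b → d v p ≡ c → OnLine d u v p → Col a b c
  onLine⇒col {u = u} {v} {p} refl refl refl = Equivalence.to (OnLine⇔Col u v p)

  col⇒onLine : ∀ {a b c u v p} → d u v ≡ a → d u p ≡ b → d v p ≡ c → Col a b c → OnLine d u v p
  col⇒onLine {u = u} {v} {p} refl refl refl = Equivalence.from (OnLine⇔Col u v p)

  -- For literal distances the hidden argument is found by computation. With distances 1 and 2 the
  -- only collinear pattern is 1, 1, 2, in any order.
  on : ∀ {a b c u v p} → d u v ≡ a → d u p ≡ b → d v p ≡ c → {True (col? a b c)} → OnLine d u v p
  on e f g {t} = col⇒onLine e f g (toWitness t)

  off : ∀ {a b c u v p} → d u v ≡ a → d u p ≡ b → d v p ≡ c → {False (col? a b c)} → ¬ OnLine d u v p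
  off e f g {t} = toWitnessFalse t ∘ onLine⇒col e f g

  onLine? : ∀ u v p → Dec (OnLine d u v p)
  onLine? u v p = map′ (col⇒onLine refl refl refl) (onLine⇒col refl refl refl) (col? _ _ _)

  onLine-left : ∀ u v → OnLine d u v u
  onLine-left u v = inj₁ (cong (_+ d u v) (dxx≡0 u))

  onLine-swap : ∀ {u v p} → OnLine d u v p → OnLine d v u p
  onLine-swap {u} {v} {p} on-p =
    col⇒onLine (symmetric v u) refl refl (col-swap (onLine⇒col refl refl refl on-p))

  onLine-right : ∀ u v → OnLine d u v v
  onLine-right u v = onLine-swap (onLine-left v u)

  onLine-rotate : ∀ {u v p} → OnLine d u v p → OnLine d p u v
  onLine-rotate {u} {v} {p} on-p =
    col⇒onLine (symmetric p u) (symmetric p v) refl (col-rotate (onLine⇒col refl refl refl on-p))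

  -- For `u ≡ v` the first equation of `OnLine` holds trivially, so a degenerate pair misses no
  -- point.
  off⇒≢ : ∀ {u v p} → ¬ OnLine d u v p → u ≢ v
  off⇒≢ {u} {p = p} ¬on refl = ¬on (inj₁ (trans (cong (d p u +_) (dxx≡0 u)) (ℕ.+-identityʳ _)))

  Twins : Fin n → Fin n → Set
  Twins u v = Non u v × (∀ p → p ≢ u → p ≢ v → d u p ≡ d v p)

  twins? : ∀ u v → Dec (Twins u v)
  twins? u v = (d u v ℕ.≟ 2) ×-dec all? (λ p → ¬? (p ≟ u) →-dec (¬? (p ≟ v) →-dec (d u p ℕ.≟ d v p)))

  -- Coincident lines through a common point.

  module _ {u v w : Fin n} (same : SameLine d u v u w) where

    transfer : ∀ p → OnLine d u v p → OnLine d u w p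
    transfer p = Equivalence.to (same p)

    transfer⁻ : ∀ p → OnLine d u w p → OnLine d u v p
    transfer⁻ p = Equivalence.from (same p)

    -- As `uv` is 1, a further point `p` is on that line exactly when `d u p` and `d v p` differ;
    -- the same holds for `uw`. Agreement at `p` thus forces `d v p ≡ d w p`.
    sameLine-Adj-Adj : v ≢ w → Adj u v → Adj u w → Twins v w
    sameLine-Adj-Adj v≢w uv uw = vw , agree
      where
      vw : Non v w
      vw with adj∨non v≢w
      ... | inj₁ e = contradiction (transfer v (onLine-right u v)) (off uw uv (flip-d e))
      ... | inj₂ f = f
      agree : ∀ p → p ≢ v → p ≢ w → d v p ≡ d w p
      agree p p≢v p≢w with p ≟ u
      ... | yes refl = trans (flip-d uv) (sym (flip-d uw))
      ... | no p≢u with adj∨non (p≢u ∘ sym) | adj∨non (p≢v ∘ sym) | adj∨non (p≢w ∘ sym)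
      ... | _ | inj₁ vp | inj₁ wp = trans vp (sym wp)
      ... | _ | inj₂ vp | inj₂ wp = trans vp (sym wp)
      ... | inj₁ up | inj₁ vp | inj₂ wp = contradiction (transfer⁻ p (on uw up wp)) (off uv up vp)
      ... | inj₁ up | inj₂ vp | inj₁ wp = contradiction (transfer p (on uv up vp)) (off uw up wp)
      ... | inj₂ up | inj₁ vp | inj₂ wp = contradiction (transfer p (on uv up vp)) (off uw up wp)
      ... | inj₂ up | inj₂ vp | inj₁ wp = contradiction (transfer⁻ p (on uw up wp)) (off uv up vp)

    sameLine-Non-Non : v ≢ w → Non u v → ¬ Non u w
    sameLine-Non-Non v≢w uv uw with adj∨non v≢w
    ... | inj₁ vw = off uv uw vw (transfer⁻ w (onLine-right u w))
    ... | inj₂ vw = off uv uw vw (transfer⁻ w (onLine-right u w))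

    module _ (uv : Adj u v) (uw : Non u w) where

      sameLine-Adj-Non : Adj v w
      sameLine-Adj-Non with adj∨non (Adj-Non-≢ uv uw)
      ... | inj₁ e = e
      ... | inj₂ f = contradiction (transfer⁻ w (onLine-right u w)) (off uv uw f)

      -- For a neighbour `p` of `u`, lying on `uv` means `Non v p` and lying on `uw` means
      -- `Adj w p`.
      adjacent-to-one : ∀ {p} → p ≢ v → Adj u p → (Adj v p × Non w p) ⊎ (Non v p × Adj w p)
      adjacent-to-one {p} p≢v up with adj∨non (p≢v ∘ sym) | adj∨non (Adj-Non-≢ up uw ∘ sym)
      ... | inj₁ vp | inj₂ wp = inj₁ (vp , wp)
      ... | inj₂ vp | inj₁ wp = inj₂ (vp , wp)
      ... | inj₁ vp | inj₁ wp = contradiction (transfer⁻ p (on uw up wp)) (off uv up vp)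
      ... | inj₂ vp | inj₂ wp = contradiction (transfer p (on uv up vp)) (off uw up wp)

      -- Two distances 2 keep `p` off `uw`, while `Adj v p` would put it on `uv`. So `w` is the only
      -- non-neighbour of `u` adjacent to `v`.
      nonadjacent : ∀ {p} → p ≢ w → Non u p → Non v p
      nonadjacent {p} p≢w up with adj∨non (Adj-Non-≢ uv up)
      ... | inj₂ vp = vp
      ... | inj₁ vp with adj∨non (p≢w ∘ sym)
      ... | inj₁ wp = contradiction (transfer p (on uv up vp)) (off uw up wp)
      ... | inj₂ wp = contradiction (transfer p (on uv up vp)) (off uw up wp)

  -- Spaces without twins.

  module TwinFree (no-twins : ∀ v w → ¬ Twins v w) (u : Fin n) (u₀ : Fin n) (u≢u₀ : u ≢ u₀) where

    Coincide : Fin n → Fin n → Set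
    Coincide v w = Adj u v × Non u w × SameLine d u v u w

    V : Fin n → Set
    V v = ∃ (Coincide v)

    sameLine? : ∀ a b x y → Dec (SameLine d a b x y)
    sameLine? a b x y = all? λ p →
      map′ (λ (f , g) → mk⇔ f g) (λ e → Equivalence.to e , Equivalence.from e)
           ((onLine? a b p →-dec onLine? x y p) ×-dec (onLine? x y p →-dec onLine? a b p))

    V? : ∀ v → Dec (V v)
    V? v = any? λ w → (d u v ℕ.≟ 1) ×-dec (d u w ℕ.≟ 2) ×-dec sameLine? u v u w

    pencil-distinct : ∀ {p q} → p ≢ u → q ≢ u → ¬ V p → ¬ V q → p ≢ q → ¬ SameLine d u p u q
    pencil-distinct p≢u q≢u ¬Vp ¬Vq p≢q same with adj∨non (p≢u ∘ sym) | adj∨non (q≢u ∘ sym)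
    ... | inj₁ up | inj₁ uq = no-twins _ _ (sameLine-Adj-Adj same p≢q up uq)
    ... | inj₁ up | inj₂ uq = ¬Vp (_ , up , uq , same)
    ... | inj₂ up | inj₁ uq = ¬Vq (_ , uq , up , SameLine-sym same)
    ... | inj₂ up | inj₂ uq = sameLine-Non-Non same p≢q up uq

    -- G p a b says that the line ab is assigned to the point p.
    complete-pencil : (G : Fin n → Fin n → Fin n → Set) →
      (∀ {p a b} → G p a b → ¬ OnLine d a b u) →
      (∀ {p q a b a′ b′} → p ≢ q → G p a b → G q a′ b′ → ¬ SameLine d a b a′ b′) →
      (∀ p → ∃₂ (G p) ⊎ (p ≢ u × ¬ V p)) →
      AtLeastNLines d
    complete-pencil G off-u distinct assign =
      (λ p → left (assign p)) , (λ p → right (assign p)) , (λ p → left≢right (assign p)) ,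
      λ p q p≢q → lines-distinct p≢q (assign p) (assign q)
      where
      Choice : Fin n → Set
      Choice p = ∃₂ (G p) ⊎ (p ≢ u × ¬ V p)
      left right : ∀ {p} → Choice p → Fin n
      left (inj₁ (a , _)) = a
      left (inj₂ _) = u
      right (inj₁ (_ , b , _)) = b
      right {p} (inj₂ _) = p
      left≢right : ∀ {p} (c : Choice p) → left c ≢ right c
      left≢right (inj₁ (_ , _ , g)) = off⇒≢ (off-u g)
      left≢right (inj₂ (p≢u , _)) = p≢u ∘ sym
      lines-distinct : ∀ {p q} → p ≢ q → (c : Choice p) (c′ : Choice q) →
                       ¬ SameLine d (left c) (right c) (left c′) (right c′)
      lines-distinct p≢q (inj₁ (_ , _ , g)) (inj₁ (_ , _ , g′)) = distinct p≢q g g′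
      lines-distinct p≢q (inj₁ (_ , _ , g)) (inj₂ _) = separate′ u (off-u g) (onLine-left u _)
      lines-distinct p≢q (inj₂ _) (inj₁ (_ , _ , g)) = separate u (onLine-left u _) (off-u g)
      lines-distinct p≢q (inj₂ (p≢u , ¬Vp)) (inj₂ (q≢u , ¬Vq)) = pencil-distinct p≢u q≢u ¬Vp ¬Vq p≢q

    no-coincidence : (∀ p → ¬ V p) → Conclusion d
    no-coincidence ¬V with any? (λ a → any? (λ b → ¬? (onLine? a b u)))
    -- Each `u₀p` passes through `u`; rotating the triple puts `p` on `uu₀`.
    ... | no all-on = inj₂ (u , u₀ , u≢u₀ , λ p →
            onLine-rotate (decidable-stable (onLine? u₀ p u) λ ¬on → all-on (u₀ , p , ¬on)))
    ... | yes (a , b , ¬on) = inj₁ (complete-pencil G off-u distinct assign)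
      where
      G : Fin n → Fin n → Fin n → Set
      G p x y = p ≡ u × x ≡ a × y ≡ b
      off-u : ∀ {p x y} → G p x y → ¬ OnLine d x y u
      off-u (_ , refl , refl) = ¬on
      distinct : ∀ {p q x y x′ y′} → p ≢ q → G p x y → G q x′ y′ → ¬ SameLine d x y x′ y′
      distinct p≢q (refl , _) (refl , _) = contradiction refl p≢q
      assign : ∀ p → ∃₂ (G p) ⊎ (p ≢ u × ¬ V p)
      assign p with p ≟ u
      ... | yes p≡u = inj₁ (a , b , p≡u , refl , refl)
      ... | no p≢u = inj₂ (p≢u , ¬V p)

    -- Both `up` and `uq` equal `uw`, so different `p` and `q` would be twins.
    coincide-unique : ∀ {p q w} → Coincide p w → Coincide q w → ¬ (p ≢ q)
    coincide-unique (up , _ , s) (uq , _ , t) p≢q = no-twins _ _ (sameLine-Adj-Adj same p≢q up uq)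
      where
      same : SameLine d u _ u _
      same x = mk⇔ (Equivalence.from (t x) ∘ Equivalence.to (s x)) (Equivalence.from (s x) ∘ Equivalence.to (t x))

    module Coincidence {v w b : Fin n} (c : Coincide v w) (¬on : ¬ OnLine d v w b) where
      private
        uv = proj₁ c
        uw = proj₁ (proj₂ c)
        same = proj₂ (proj₂ c)
        vw = sameLine-Adj-Non same uv uw

      b≢u : b ≢ u
      b≢u refl = ¬on (on vw (flip-d uv) (flip-d uw))

      b≢v : b ≢ v
      b≢v refl = ¬on (onLine-left v w)

      b≢w : b ≢ w
      b≢w refl = ¬on (onLine-right v w)

      -- A neighbour of `u` other than `v` is adjacent to exactly one of `v`, `w`, hence lies on
      -- `vw`, which misses `b`.
      ub : Non u b
      ub with adj∨non (b≢u ∘ sym)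
      ... | inj₂ f = f
      ... | inj₁ e with adjacent-to-one same uv uw b≢v e
      ... | inj₁ (vb , wb) = contradiction (on vw vb wb) ¬on
      ... | inj₂ (vb , wb) = contradiction (on vw vb wb) ¬on

      vb : Non v b
      vb = nonadjacent same uv uw b≢w ub

      wb : Non w b
      wb with adj∨non (b≢w ∘ sym)
      ... | inj₂ f = f
      ... | inj₁ e = contradiction (on vw vb e) ¬on

      -- `v` is adjacent to exactly one of `p` and its partner `x`. It is not `x`, since `w` is the
      -- only non-neighbour of `u` adjacent to `v`.
      V⇒Adj-v : ∀ {p} → p ≢ v → V p → Adj v p
      V⇒Adj-v {p} p≢v (x , c′@(up , ux , s)) with adjacent-to-one s up ux (p≢v ∘ sym) uv
      ... | inj₁ (pv , _) = flip-d pv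
      ... | inj₂ (_ , xv) = contradiction (nonadjacent same uv uw x≢w ux) (¬Adj∧Non (flip-d xv))
        where
        x≢w : x ≢ w
        x≢w refl = coincide-unique c′ c p≢v

      V⇒Non-w : ∀ {p} → p ≢ v → V p → Non p w
      V⇒Non-w p≢v (x , c′@(up , ux , s)) = nonadjacent s up ux w≢x uw
        where
        w≢x : w ≢ x
        w≢x refl = coincide-unique c′ c p≢v

      -- The partner of `p` is the only non-neighbour of `u` adjacent to `p`, so it is `b`. By
      -- `coincide-unique` this happens for at most one `p`.
      V⇒Coincide-b : ∀ {p} → V p → Adj p b → Coincide p b
      V⇒Coincide-b (x , c′@(up , ux , s)) pb with b ≟ x
      ... | yes refl = c′
      ... | no b≢x = contradiction (nonadjacent s up ux b≢x ub) (¬Adj∧Non pb)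

      -- The point `v` itself falls under `far`, as `vb` is 2, so `near` never yields the pair `v`,
      -- `v`.
      data G : Fin n → Fin n → Fin n → Set where
        base : G u w b
        far  : ∀ {p} → V p → Non p b → G p p b
        near : ∀ {p} → V p → Adj p b → G p v p

      Adj-b⇒≢v : ∀ {p} → Adj p b → p ≢ v
      Adj-b⇒≢v pb refl = ¬Adj∧Non pb vb

      off-u : ∀ {p x y} → G p x y → ¬ OnLine d x y u
      off-u base = off wb (flip-d uw) (flip-d ub)
      off-u (far (_ , up , _) pb) = off pb (flip-d up) (flip-d ub)
      off-u (near Vp@(_ , up , _) pb) = off (V⇒Adj-v (Adj-b⇒≢v pb) Vp) (flip-d uv) (flip-d up)

      -- Two of the three distances are 2. This separates `base` from the other labels and the `far`
      -- labels from each other.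
      off-b : ∀ {x p} → x ≢ p → Non x b → Non p b → ¬ OnLine d x b p
      off-b x≢p xb pb with adj∨non x≢p
      ... | inj₁ e = off xb e (flip-d pb)
      ... | inj₂ f = off xb f (flip-d pb)

      V⇒≢w : ∀ {p} → V p → w ≢ p
      V⇒≢w (_ , up , _) = Adj-Non-≢ up uw ∘ sym

      far≁near : ∀ {p q} → V p → Non p b → V q → Adj q b → ¬ SameLine d p b v q
      far≁near {p} {q} Vp pb Vq qb with p ≟ v
      ... | no p≢v = separate′ v (off-b p≢v pb vb) (onLine-left v q)
      -- Here `v` lies on both lines, so `w` takes over as the separating point.
      ... | yes refl = separate′ w (off vb vw (flip-d wb)) (on (V⇒Adj-v q≢v Vq) vw (V⇒Non-w q≢v Vq))
        where
        q≢v = Adj-b⇒≢v qb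

      distinct : ∀ {p q x y x′ y′} → p ≢ q → G p x y → G q x′ y′ → ¬ SameLine d x y x′ y′
      distinct p≢q base base = contradiction refl p≢q
      distinct p≢q base (far Vq qb) = separate′ _ (off-b (V⇒≢w Vq) wb qb) (onLine-left _ b)
      distinct p≢q base (near Vq qb) = separate′ v (off-b (V⇒≢w (w , c)) wb vb) (onLine-left v _)
      distinct p≢q (far Vp pb) base = separate _ (onLine-left _ b) (off-b (V⇒≢w Vp) wb pb)
      distinct p≢q (far Vp pb) (far Vq qb) = separate _ (onLine-left _ b) (off-b (p≢q ∘ sym) qb pb)
      distinct p≢q (far Vp pb) (near Vq qb) = far≁near Vp pb Vq qb
      distinct p≢q (near Vp pb) base = separate v (onLine-left v _) (off-b (V⇒≢w (w , c)) wb vb)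
      distinct p≢q (near Vp pb) (far Vq qb) = far≁near Vq qb Vp pb ∘ SameLine-sym
      distinct p≢q (near Vp pb) (near Vq qb) _ = coincide-unique (V⇒Coincide-b Vp pb) (V⇒Coincide-b Vq qb) p≢q

      assign : ∀ p → ∃₂ (G p) ⊎ (p ≢ u × ¬ V p)
      assign p with p ≟ u
      ... | yes refl = inj₁ (w , b , base)
      ... | no p≢u with V? p
      ... | no ¬Vp = inj₂ (p≢u , ¬Vp)
      ... | yes Vp with adj∨non (Adj-Non-≢ (proj₁ (proj₂ Vp)) ub)
      ... | inj₁ pb = inj₁ (v , p , near Vp pb)
      ... | inj₂ pb = inj₁ (p , b , far Vp pb)

      atLeastNLines : AtLeastNLines d
      atLeastNLines = complete-pencil G off-u distinct assign

    twinFree : Conclusion d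
    twinFree with any? V?
    ... | no ¬V = no-coincidence λ p Vp → ¬V (p , Vp)
    ... | yes (v , w , c@(uv , uw , _)) with all? (onLine? v w)
    ... | yes all-on = inj₂ (v , w , Adj-Non-≢ uv uw , all-on)
    ... | no ¬all-on with b , ¬on ← ¬∀⟶∃¬ n _ (onLine? v w) ¬all-on =
      inj₁ (Coincidence.atLeastNLines c ¬on)

  -- Twins and the lines that contain them.

  twins-on : ∀ {u u′ a b} → Twins u u′ → a ≢ u′ → b ≢ u′ → OnLine d a b u′ → OnLine d a b u
  twins-on {u} {u′} {a} {b} (_ , agree) a≢u′ b≢u′ on′ with a ≟ u | b ≟ u
  ... | yes refl | _ = onLine-left a b
  ... | no _ | yes refl = onLine-right a b
  ... | no a≢u | no b≢u =
    col⇒onLine refl (flip-d (trans (agree a a≢u a≢u′) (symmetric _ _)))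
                    (flip-d (trans (agree b b≢u b≢u′) (symmetric _ _)))
                    (onLine⇒col refl refl refl on′)

  Twins-sym : ∀ {u v} → Twins u v → Twins v u
  Twins-sym (uv , agree) = flip-d uv , λ p p≢v p≢u → sym (agree p p≢u p≢v)

  -- The side conditions exclude a line from `u` to a non-neighbour: it has `u′` at distance 2 from
  -- `u`, so two distances are 2 and it misses `u′`.
  twins-on-Adj : ∀ {u u′ a b} → Twins u u′ → a ≢ u′ → b ≢ u′ →
                 (a ≡ u → Adj u b) → (b ≡ u → Adj u a) → OnLine d a b u → OnLine d a b u′
  twins-on-Adj {u} {u′} {a} {b} t@(uu′ , agree) a≢u′ b≢u′ f g on-u with a ≟ u | b ≟ u
  ... | yes refl | _ = on (f refl) uu′ (flip-d (trans (sym (agree b (d≡⇒≢ (f refl) ∘ sym) b≢u′)) (f refl)))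
  ... | no a≢u | yes refl = on (flip-d (g refl)) (flip-d (trans (sym (agree a a≢u a≢u′)) (g refl))) uu′
  ... | no a≢u | no b≢u = twins-on (Twins-sym t) a≢u b≢u on-u

  -- Through `u`, also `v` and `w` are twins, and `rest` passes on to both of them, so the three
  -- points play symmetric roles.
  record TwinTriple : Set where
    field
      {u v w} : Fin n
      uv : Twins u v
      uw : Twins u w
      vw : Non v w
      rest : ∀ {p} → p ≢ u → p ≢ v → p ≢ w → Adj u p

-- Removal of one twin.

module _ {n : ℕ} (d : Fin (suc n) → Fin (suc n) → ℕ) (M : IsMetric d) (O : OneTwo d) where
  open Space d M O

  -- If `uz` is 1, then `u′` joins the line by the pattern 1, 2, 1. If `uz` is 2, every other point
  -- apart from `u′` must be adjacent to both `u` and `z`, which makes `u`, `u′`, `z` a triple.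
  universal-or-triple : ∀ {u u′ z} → Twins u u′ → u ≢ z → z ≢ u′ →
    (∀ {p} → p ≢ u′ → OnLine d u z p) → UniversalLine d ⊎ TwinTriple
  universal-or-triple {u} {u′} {z} t@(uu′ , agree) u≢z z≢u′ all-on with adj∨non u≢z
  ... | inj₁ uz = inj₁ (u , z , u≢z , all-on′)
    where
    all-on′ : ∀ p → OnLine d u z p
    all-on′ p with p ≟ u′
    ... | no p≢u′ = all-on p≢u′
    ... | yes refl = twins-on-Adj t (d≡⇒≢ uu′) z≢u′ (λ _ → uz) (λ e → contradiction (sym e) u≢z) (onLine-left u z)
  ... | inj₂ uz = inj₂ (record
    { uv = t ; uw = uz , agree′ ; vw = u′z
    ; rest = λ p≢u p≢u′ p≢z → proj₁ (both p≢u p≢u′ p≢z) })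
    where
    u′z : Non u′ z
    u′z = trans (sym (agree z (u≢z ∘ sym) z≢u′)) uz
    both : ∀ {p} → p ≢ u → p ≢ u′ → p ≢ z → Adj u p × Adj z p
    both p≢u p≢u′ p≢z with adj∨non (p≢u ∘ sym) | adj∨non (p≢z ∘ sym)
    ... | inj₁ up | inj₁ zp = up , zp
    ... | inj₁ up | inj₂ zp = contradiction (all-on p≢u′) (off uz up zp)
    ... | inj₂ up | inj₁ zp = contradiction (all-on p≢u′) (off uz up zp)
    ... | inj₂ up | inj₂ zp = contradiction (all-on p≢u′) (off uz up zp)
    agree′ : ∀ p → p ≢ u → p ≢ z → d u p ≡ d z p
    agree′ p p≢u p≢z with p ≟ u′
    ... | yes refl = trans uu′ (sym (flip-d u′z))
    ... | no p≢u′ with up , zp ← both p≢u p≢u′ p≢z = trans up (sym zp)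

  remove-twin : Theorem n → ∀ {u u′} → Twins u u′ → Conclusion d ⊎ TwinTriple
  remove-twin thm {u} {u′} t@(uu′ , agree) with all? (onLine? u u′)
  ... | yes all-on = inj₁ (inj₂ (u , u′ , d≡⇒≢ uu′ , all-on))
  ... | no ¬all-on with y , ¬on ← ¬∀⟶∃¬ _ _ (onLine? u u′) ¬all-on
                   with restrict thm M O (punchIn u′) (punchIn-injective u′ _ _)
  ... | inj₁ lines = inj₁ (inj₁ (Lines⇒AtLeastNLines (addLine u′ y (y≢u′ ∘ sym) new lines)))
    where
    y≢u : y ≢ u
    y≢u refl = ¬on (onLine-left u u′)
    y≢u′ : y ≢ u′
    y≢u′ refl = ¬on (onLine-right u u′)
    -- A common neighbour of the twins would lie on `uu′`.
    uy : Non u y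
    uy with adj∨non (y≢u ∘ sym)
    ... | inj₂ f = f
    ... | inj₁ e = contradiction (on uu′ e (trans (sym (agree y y≢u y≢u′)) e)) ¬on
    new : ∀ {a b} → a ≢ b → (∃[ i ] punchIn u′ i ≡ a) × (∃[ j ] punchIn u′ j ≡ b) → ¬ SameLine d a b u′ y
    new _ ((i , refl) , (j , refl)) same =
      off (trans (sym (agree y y≢u y≢u′)) uy) (flip-d uu′) (flip-d uy)
        (Equivalence.to (same u) (twins-on t (punchInᵢ≢i u′ i) (punchInᵢ≢i u′ j)
          (Equivalence.from (same u′) (onLine-left u′ y))))
  ... | inj₂ (i , j , x≢z , all-on) with onLine? (punchIn u′ i) (punchIn u′ j) u′
  ... | yes on-u′ = inj₁ (inj₂ (punchIn u′ i , punchIn u′ j , x≢z , all-on′))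
    where
    all-on′ : ∀ p → OnLine d (punchIn u′ i) (punchIn u′ j) p
    all-on′ p with p ≟ u′
    ... | yes refl = on-u′
    ... | no p≢u′ with k , refl ← punchIn-surjective p≢u′ = all-on k
  -- The line contains `u` but not its twin `u′`, which is only possible when `u` is one of its
  -- ends.
  ... | no off-u′ with punchIn u′ i ≟ u | punchIn u′ j ≟ u
  ... | yes refl | _ =
    [ inj₁ ∘ inj₂ , inj₂ ]′ (universal-or-triple t x≢z (punchInᵢ≢i u′ j)
      λ p≢u′ → subst (OnLine d _ _) (proj₂ (punchIn-surjective p≢u′)) (all-on _))
  ... | no _ | yes refl =
    [ inj₁ ∘ inj₂ , inj₂ ]′ (universal-or-triple t (x≢z ∘ sym) (punchInᵢ≢i u′ i)
      λ p≢u′ → onLine-swap (subst (OnLine d _ _) (proj₂ (punchIn-surjective p≢u′)) (all-on _)))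
  ... | no x≢u | no z≢u = contradiction
    (twins-on (Twins-sym t) x≢u z≢u
      (subst (OnLine d _ _) (proj₂ (punchIn-surjective (d≡⇒≢ uu′))) (all-on _))) off-u′

  step : Theorem n → (TwinTriple → Conclusion d) → (u u₀ : Fin (suc n)) → u ≢ u₀ → Conclusion d
  step thm triple u u₀ u≢u₀ with any? (λ v → any? (twins? v))
  ... | no ¬twins = TwinFree.twinFree (λ v w t → ¬twins (v , w , t)) u u₀ u≢u₀
  ... | yes (v , w , t) = [ (λ c → c) , triple ]′ (remove-twin thm t)

-- Triples of mutual twins.

three-lines : (d : Fin 3 → Fin 3 → ℕ) (M : IsMetric d) (O : OneTwo d) → Space.TwinTriple d M O → AtLeastNLines d
three-lines d M O T =
  Lines⇒AtLeastNLines
    -- All three distances are 2, so each line misses the third point.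
    (addLine v w (d≡⇒≢ vw) (λ { _ (inj₁ (refl , refl)) → separate u (onLine-left u w) u∉vw
                              ; _ (inj₂ (inj₁ (refl , refl))) → separate u (onLine-left u v) u∉vw
                              ; _ (inj₂ (inj₂ ())) })
    (addLine u w (d≡⇒≢ (proj₁ uw)) (λ { _ (inj₁ (refl , refl)) → separate v (onLine-right u v) v∉uw
                                      ; _ (inj₂ ()) })
    (addLine u v (d≡⇒≢ (proj₁ uv)) (λ _ ())
    (noLines {λ _ _ → ⊥}))))
  where
  open Space d M O
  open TwinTriple T
  u∉vw : ¬ OnLine d v w u
  u∉vw = off vw (flip-d (proj₁ uv)) (flip-d (proj₁ uw))
  v∉uw : ¬ OnLine d u w v
  v∉uw = off (proj₁ uw) (proj₁ uv) (flip-d vw)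

remove-two : ∀ {n} → Theorem n → (d : Fin (2 + n) → Fin (2 + n) → ℕ) (M : IsMetric d) (O : OneTwo d) →
             Space.TwinTriple d M O → Conclusion d
remove-two {n} thm d M O T = finish (restrict thm M O f f-injective)
  where
  open Space d M O
  open TwinTriple T
  nuv = proj₁ uv
  nuw = proj₁ uw
  w≢v : w ≢ v
  w≢v = d≡⇒≢ (flip-d vw)
  -- Removing `w` first shifts the indices; `v′` is the place of `v` among the remaining points.
  v′ : Fin (suc n)
  v′ = punchOut w≢v
  f : Fin n → Fin (2 + n)
  f = punchIn w ∘ punchIn v′
  f-injective : Injective _≡_ _≡_ f
  f-injective = punchIn-injective v′ _ _ ∘ punchIn-injective w _ _
  f≢w : ∀ i → f i ≢ w
  f≢w i = punchInᵢ≢i w _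
  f≢v : ∀ i → f i ≢ v
  f≢v i e = punchInᵢ≢i v′ i (punchIn-injective w _ _ (trans e (sym (punchIn-punchOut w≢v))))
  f-surjective : ∀ {p} → p ≢ v → p ≢ w → ∃[ i ] f i ≡ p
  f-surjective {p} p≢v p≢w with k , refl ← punchIn-surjective p≢w
                           with k ≟ v′
  ... | yes refl = contradiction (punchIn-punchOut w≢v) p≢v
  ... | no k≢v′ = punchOut (k≢v′ ∘ sym) , cong (punchIn w) (punchIn-punchOut (k≢v′ ∘ sym))

  -- Of the triple only `u` is in the image of `f`, so an old line ending in `u` has an adjacent
  -- other end. Hence old lines through `u` contain `v` and `w`, whereas `uv` misses `w` and `uw`
  -- misses `v`.
  rest′ : ∀ {a} i → f i ≢ a → a ≡ u → Adj u (f i)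
  rest′ i fi≢a refl = rest fi≢a (f≢v i) (f≢w i)

  u⇒v : ∀ {i j} → f i ≢ f j → OnLine d (f i) (f j) u → OnLine d (f i) (f j) v
  u⇒v {i} {j} ne = twins-on-Adj uv (f≢v i) (f≢v j) (rest′ j (ne ∘ sym)) (rest′ i ne)

  u⇒w : ∀ {i j} → f i ≢ f j → OnLine d (f i) (f j) u → OnLine d (f i) (f j) w
  u⇒w {i} {j} ne = twins-on-Adj uw (f≢w i) (f≢w j) (rest′ j (ne ∘ sym)) (rest′ i ne)

  v∉uw : ¬ OnLine d u w v
  v∉uw = off nuw nuv (flip-d vw)
  w∉uv : ¬ OnLine d u v w
  w∉uv = off nuv nuw vw

  Old : Fin (2 + n) → Fin (2 + n) → Set
  Old a b = (∃[ i ] f i ≡ a) × (∃[ j ] f j ≡ b)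

  old≁uv : ∀ {a b} → a ≢ b → Old a b → ¬ SameLine d a b u v
  old≁uv ne ((i , refl) , (j , refl)) same =
    w∉uv (Equivalence.to (same w) (u⇒w ne (Equivalence.from (same u) (onLine-left u v))))

  new≁uw : ∀ {a b} → a ≢ b → (a ≡ u × b ≡ v) ⊎ Old a b → ¬ SameLine d a b u w
  new≁uw _ (inj₁ (refl , refl)) = separate v (onLine-right u v) v∉uw
  new≁uw ne (inj₂ ((i , refl) , (j , refl))) same =
    v∉uw (Equivalence.to (same v) (u⇒v ne (Equivalence.from (same u) (onLine-left u w))))

  finish : Lines d n Old ⊎ (∃[ i ] ∃[ j ] (f i ≢ f j × (∀ k → OnLine d (f i) (f j) (f k)))) → Conclusion d
  finish (inj₁ lines) =
    inj₁ (Lines⇒AtLeastNLines (addLine u w (d≡⇒≢ nuw) new≁uw (addLine u v (d≡⇒≢ nuv) old≁uv lines)))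
  finish (inj₂ (i , j , ne , all-on)) = inj₂ (f i , f j , ne , all-on′)
    where
    on-u : OnLine d (f i) (f j) u
    on-u = subst (OnLine d _ _) (proj₂ (f-surjective (d≡⇒≢ nuv) (d≡⇒≢ nuw))) (all-on _)
    all-on′ : ∀ p → OnLine d (f i) (f j) p
    all-on′ p with p ≟ v | p ≟ w
    ... | yes refl | _ = u⇒v ne on-u
    ... | no _ | yes refl = u⇒w ne on-u
    ... | no p≢v | no p≢w with k , refl ← f-surjective p≢v p≢w = all-on k

-- Induction on the number of points.

theorem≥2 : ∀ n → Theorem (2 + n)
theorem≥2 zero d M O = inj₂ (zero , suc zero , (λ ()) , λ { zero → onLine-left _ _ ; (suc zero) → onLine-right _ _ })
  where open Space d M O
-- Removing two of three points would leave a single one, for which the statement is false; hence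
-- the direct treatment of a triple.
theorem≥2 (suc zero) d M O =
  step d M O (theorem≥2 zero) (inj₁ ∘ three-lines d M O) zero (suc zero) λ ()
theorem≥2 (suc (suc n)) d M O =
  step d M O (theorem≥2 (suc n)) (remove-two (theorem≥2 n) d M O) zero (suc zero) λ ()

theorem1 : (n : ℕ) → 2 ≤ n → (dist : Fin n → Fin n → ℕ) →
    IsMetric dist → OneTwo dist →
    AtLeastNLines dist ⊎ UniversalLine dist
theorem1 (suc (suc n)) (s≤s (s≤s z≤n)) = theorem≥2 n
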